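{- The Lambda word $\Lambda_\theta$ is rich; that is, every nonempty prefix of $\Lambda_\theta$ has a nonempty palindromic suffix that occurs exactly once in that prefix, and equivalently every finite factor $w$ of $\Lambda_\theta$ contains exactly $|w|+1$ distinct palindromic factors (counting the empty word).
   Context: Fix an irrational $\theta$ with $1<\theta<2$. Let $S(\theta)=\{i+j\theta : i,j\in\mathbb{N}_0\}$ and let $s_0<s_1<s_2<\cdots$ be its elements in increasing order. Put $\delta(n)=s_{n+1}-s_n$. Let $\lambda$ be the map from the set of values $\{\delta(n):n\ge0\}$ to $\mathbb{N}_0$ that numbers the distinct values in order of first occurrence: $\lambda(\delta(0))=0$, and the $m$-th distinct value to appear in the sequence $\delta(0),\delta(1),\dots$ (counting from $m=0$) receives label $m$. The Lambda word is the right-infinite word $\Lambda_\theta=\lambda(\delta(0))\lambda(\delta(1))\lambda(\delta(2))\cdots$ over the alphabet $\mathbb{N}_0$. A factor is a finite block of consecutive letters; a palindrome is a finite word equal to its reversal; $|w|$ denotes the length of $w$. A finite word of length $n$ is rich if it has exactly $n+1$ distinct palindromic factors (including the empty word), and an infinite word is rich if all its finite factors are rich. -}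

module Defs where

open import Algebra.Bundles.Raw using (RawMonoid)
import Algebra.Definitions.RawMonoid as RawMonoidDefs
open import Data.Integer.Base using (+_)
open import Data.List.Base using (List; []; _++_; applyUpTo; length; reverse)
open import Data.List.Membership.Propositional using (_∈_)
open import Data.List.Relation.Binary.Infix.Heterogeneous using (Infix)
open import Data.List.Relation.Binary.Suffix.Heterogeneous using (Suffix)
open import Data.List.Relation.Unary.Unique.Propositional using (Unique)
open import Data.Nat.Base using (ℕ; zero; suc; _⊔_)
import Data.Nat.Base as ℕ
import Data.Nat.Properties as ℕ
open import Data.Product.Base using (∃; ∃-syntax; _×_; _,_)
open import Data.Product using (∃!)
open import Data.Rational.Base using (ℚ; 0ℚ; ½; _/_; _+_; _-_; -_; _*_; _<_; ∣_∣)
import Data.Rational.Properties as ℚ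
open import Data.Rational.Solver using (module +-*-Solver)
open import Function.Base using (_∘_)
open import Function.Bundles using (_⇔_)
open import Level using (0ℓ)
open import Relation.Binary.PropositionalEquality
  using (_≡_; _≢_; refl; sym; trans; cong; subst)
open import Relation.Nullary.Negation using (¬_)

IsCauchy : (ℕ → ℚ) → Set
IsCauchy x = ∀ ε → 0ℚ < ε →
  ∃[ N ] ∀ m n → N ℕ.≤ m → N ℕ.≤ n → ∣ x m - x n ∣ < ε

record ℝ : Set where
  constructor mkℝ
  field
    seq    : ℕ → ℚ
    cauchy : IsCauchy seq

open ℝ public

infix 4 _≃_ _<ʳ_

_≃_ : ℝ → ℝ → Set
x ≃ y = ∀ ε → 0ℚ < ε → ∃[ N ] ∀ n → N ℕ.≤ n → ∣ seq x n - seq y n ∣ < ε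

_<ʳ_ : ℝ → ℝ → Set
x <ʳ y = ∃[ ε ] 0ℚ < ε × ∃[ N ] ∀ n → N ℕ.≤ n → seq x n + ε < seq y n

private
  ∣p-p∣<ε : ∀ p {ε} → 0ℚ < ε → ∣ p - p ∣ < ε
  ∣p-p∣<ε p {ε} 0<ε =
    subst (λ q → ∣ q ∣ < ε) (sym (ℚ.+-inverseʳ p)) 0<ε

  0<½ε : ∀ {ε} → 0ℚ < ε → 0ℚ < ½ * ε
  0<½ε {ε} 0<ε =
    subst (_< ½ * ε) (ℚ.*-zeroʳ ½) (ℚ.*-monoʳ-<-pos ½ 0<ε)

  ½ε+½ε : ∀ ε → ½ * ε + ½ * ε ≡ ε
  ½ε+½ε ε = trans (sym (ℚ.*-distribʳ-+ ε ½ ½)) (ℚ.*-identityˡ ε)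

  interchange : ∀ a b c d → (a + b) - (c + d) ≡ (a - c) + (b - d)
  interchange = solve 4
    (λ a b c d → ((a :+ b) :- (c :+ d)) := ((a :- c) :+ (b :- d))) refl
    where open +-*-Solver

  neg-diff : ∀ a b → - a - - b ≡ - (a - b)
  neg-diff = solve 2 (λ a b → ((:- a) :- (:- b)) := (:- (a :- b))) refl
    where open +-*-Solver

≃-refl : ∀ {x} → x ≃ x
≃-refl {x} ε 0<ε = 0 , λ n _ → ∣p-p∣<ε (seq x n) 0<ε

fromℚ : ℚ → ℝ
fromℚ q = mkℝ (λ _ → q) (λ ε 0<ε → 0 , λ _ _ _ _ → ∣p-p∣<ε q 0<ε)

fromℕ : ℕ → ℝ
fromℕ n = fromℚ (+ n / 1)

infixl 6 _+ʳ_ _-ʳ_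
infix  8 -ʳ_

_+ʳ_ : ℝ → ℝ → ℝ
x +ʳ y = mkℝ (λ n → seq x n + seq y n) isCauchy
  where
  isCauchy : IsCauchy (λ n → seq x n + seq y n)
  isCauchy ε 0<ε with cauchy x (½ * ε) (0<½ε 0<ε) | cauchy y (½ * ε) (0<½ε 0<ε)
  ... | M , close-x | N , close-y = M ⊔ N , λ m n le le′ →
    begin-strict
      ∣ (seq x m + seq y m) - (seq x n + seq y n) ∣
        ≡⟨ cong ∣_∣ (interchange (seq x m) (seq y m) (seq x n) (seq y n)) ⟩
      ∣ (seq x m - seq x n) + (seq y m - seq y n) ∣
        ≤⟨ ℚ.∣p+q∣≤∣p∣+∣q∣ (seq x m - seq x n) (seq y m - seq y n) ⟩
      ∣ seq x m - seq x n ∣ + ∣ seq y m - seq y n ∣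
        <⟨ ℚ.+-mono-<
             (close-x m n (ℕ.m⊔n≤o⇒m≤o M N le) (ℕ.m⊔n≤o⇒m≤o M N le′))
             (close-y m n (ℕ.m⊔n≤o⇒n≤o M N le) (ℕ.m⊔n≤o⇒n≤o M N le′)) ⟩
      ½ * ε + ½ * ε
        ≡⟨ ½ε+½ε ε ⟩
      ε ∎
    where open ℚ.≤-Reasoning

-ʳ_ : ℝ → ℝ
-ʳ x = mkℝ (λ n → - seq x n) isCauchy
  where
  isCauchy : IsCauchy (λ n → - seq x n)
  isCauchy ε 0<ε with cauchy x ε 0<ε
  ... | N , close = N , λ m n le le′ →
    subst (_< ε)
      (sym (trans (cong ∣_∣ (neg-diff (seq x m) (seq x n)))
                  (ℚ.∣-p∣≡∣p∣ (seq x m - seq x n))))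
      (close m n le le′)

_-ʳ_ : ℝ → ℝ → ℝ
x -ʳ y = x +ʳ -ʳ y

+ʳ-rawMonoid : RawMonoid 0ℓ 0ℓ
+ʳ-rawMonoid = record
  { Carrier = ℝ
  ; _≈_     = _≃_
  ; _∙_     = _+ʳ_
  ; ε       = fromℕ 0
  }

-- j · x is the product of the natural number j and x
open RawMonoidDefs +ʳ-rawMonoid public using () renaming (_×_ to _·_)

Irrational : ℝ → Set
Irrational x = ∀ q → ¬ (x ≃ fromℚ q)

S : ℝ → ℝ → Set
S θ x = ∃[ i ] ∃[ j ] x ≃ fromℕ i +ʳ j · θ

-- An enumeration is determined up to ≃; for P = S θ with θ irrational it also
-- makes the order and equality on S θ decidable, so that no apartness
-- assumption is needed in Irrational.
record IsIncreasingEnumeration (P : ℝ → Set) (s : ℕ → ℝ) : Set where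
  field
    increasing : ∀ n → s n <ʳ s (suc n)
    sound      : ∀ n → P (s n)
    complete   : ∀ x → P x → ∃[ n ] x ≃ s n

gap : (ℕ → ℝ) → ℕ → ℝ
gap s n = s (suc n) -ʳ s n

Value : (ℕ → ℝ) → ℝ → Set
Value d x = ∃[ n ] x ≃ d n

IsNew : (ℕ → ℝ) → ℕ → Set
IsNew d n = ∀ k → k ℕ.< n → ¬ (d k ≃ d n)

-- NthNew d m p: the m-th distinct value of d, counting from 0, first
-- appears at position p.
data NthNew (d : ℕ → ℝ) : ℕ → ℕ → Set where
  first : NthNew d 0 0
  next  : ∀ {m p q} → NthNew d m p → p ℕ.< q → IsNew d q →
          (∀ k → p ℕ.< k → k ℕ.< q → ¬ IsNew d k) →
          NthNew d (suc m) q

Labelling : (ℕ → ℝ) → Set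
Labelling d = ∀ x → Value d x → ℕ

-- Labels do not depend on the representative x nor on the proof that x is a
-- value of d, since both are universally quantified here.
IsFirstOccurrenceLabelling : (d : ℕ → ℝ) → Labelling d → Set
IsFirstOccurrenceLabelling d label =
  ∀ {m p} → NthNew d m p → ∀ x (x∈d : Value d x) → x ≃ d p → label x x∈d ≡ m

labelWord : (d : ℕ → ℝ) → Labelling d → ℕ → ℕ
labelWord d label n = label (d n) (n , ≃-refl {d n})

module _ {A : Set} where

  -- A right-infinite word is a function on positions, a finite word a list.
  prefix : (ℕ → A) → ℕ → List A
  prefix W n = applyUpTo W n

  block : (ℕ → A) → ℕ → ℕ → List A
  block W i n = applyUpTo (λ k → W (i ℕ.+ k)) n

  Palindrome : List A → Set
  Palindrome w = reverse w ≡ w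

  OccursAt : List A → List A → ℕ → Set
  OccursAt u w i = ∃[ p ] ∃[ q ] w ≡ p ++ u ++ q × length p ≡ i

  OccursOnce : List A → List A → Set
  OccursOnce u w = ∃! _≡_ (OccursAt u w)

  PalindromicFactor : List A → List A → Set
  PalindromicFactor w u = Palindrome u × Infix _≡_ u w

  HasCardinality : (List A → Set) → ℕ → Set
  HasCardinality P n =
    ∃[ us ] Unique us × (∀ u → u ∈ us ⇔ P u) × length us ≡ n

  Rich : List A → Set
  Rich w = HasCardinality (PalindromicFactor w) (suc (length w))

  Rich∞ : (ℕ → A) → Set
  Rich∞ W = ∀ i n → Rich (block W i n)

  HasUnioccurrentPalindromicSuffix : List A → Set
  HasUnioccurrentPalindromicSuffix w =
    ∃[ u ] u ≢ [] × Palindrome u × Suffix _≡_ u w × OccursOnce u w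

{-# OPTIONS --safe #-}

-- Write the points of S(θ) as pairs (i , j) ∈ ℕ², listed by increasing i + jθ; two
-- letters of Λ agree exactly when the corresponding steps agree in ℤ². Let e = s_N
-- with N > 0, let m and l be the greatest first and second coordinates among
-- s_0, …, s_N, and put c = m + lθ. Then x ↦ c − x reverses S ∩ [c − e , e], so the
-- steps in this interval spell a palindromic suffix of the prefix of length N.
-- The interval contains (m , 0) and (0 , l); an earlier occurrence would be a
-- translate by a negative element of ℤ + ℤθ with both coordinates nonnegative.
-- Hence every prefix ends in a palindrome that is new in it.
module Submission where

open import Defs
open import Data.Empty using (⊥)
import Data.Integer.Base as ℤ
import Data.Integer.Properties as ℤ
open import Data.List.Base using (List; []; _∷_; _++_; applyUpTo; applyDownFrom; length; reverse)
open import Data.List.Membership.Propositional using (_∈_)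
open import Data.List.Properties
  using (∷-injective; ++-assoc; ++-identityʳ; length-applyUpTo; reverse-++; reverse-applyUpTo;
         reverse-involutive; length-reverse; length-++)
open import Data.List.Relation.Binary.Infix.Heterogeneous as Infix using (Infix; MkView)
import Data.List.Relation.Binary.Pointwise as Pointwise
import Data.List.Relation.Binary.Prefix.Heterogeneous as Prefix
open import Data.List.Relation.Binary.Suffix.Heterogeneous as Suffix using (Suffix)
open import Data.List.Relation.Unary.All as All using (tabulate)
open import Data.List.Relation.Unary.AllPairs using ([]; _∷_)
open import Data.List.Relation.Unary.Any using (here; there)
open import Data.Nat.Base using (ℕ; zero; suc; _+_; _∸_; _≤_; _<_; z≤n; s≤s; s≤s⁻¹; _⊔_)
open import Data.Nat.Induction using (<-rec)
open import Data.Nat.Properties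
import Data.Nat.Solver as ℕ
open import Data.Product.Base using (∃-syntax; _×_; _,_; proj₁; proj₂)
open import Data.Product.Properties using (≡-dec)
open import Data.Rational.Base as ℚ using (ℚ; 0ℚ; 1ℚ; ½; ∣_∣)
import Data.Rational.Properties as ℚ
open import Data.Rational.Solver using (module +-*-Solver)
import Data.Rational.Unnormalised.Base as ℚᵘ
import Data.Rational.Unnormalised.Properties as ℚᵘ
open import Data.Sum.Base using (inj₁; inj₂; [_,_]′)
open import Function.Base using (_∘_)
open import Function.Bundles using (_⇔_; mk⇔; Equivalence)
open import Function.Properties.Equivalence using () renaming (sym to ⇔-sym; trans to ⇔-trans)
open import Relation.Binary.Definitions using (tri<; tri≈; tri>)
open import Relation.Binary.PropositionalEquality
  using (_≡_; _≢_; refl; sym; trans; cong; cong₂; subst; subst₂; module ≡-Reasoning)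
open import Relation.Nullary.Decidable as Dec using (Dec; yes; no)
open import Relation.Nullary.Negation using (¬_; contradiction)

-- Words

module _ {A : Set} where

  ++-injective : ∀ {xs ys xs′ ys′ : List A} → length xs ≡ length xs′ →
                xs ++ ys ≡ xs′ ++ ys′ → xs ≡ xs′ × ys ≡ ys′
  ++-injective {[]}     {xs′ = []}      _  eq = refl , eq
  ++-injective {x ∷ xs} {xs′ = x′ ∷ xs′} le eq with ∷-injective eq
  ... | refl , eq′ with ++-injective {xs} {xs′ = xs′} (suc-injective le) eq′
  ... | refl , eq″ = refl , eq″

  applyUpTo-cong : ∀ {f g : ℕ → A} n → (∀ k → k < n → f k ≡ g k) →
                   applyUpTo f n ≡ applyUpTo g n
  applyUpTo-cong zero    _   = refl
  applyUpTo-cong (suc n) f≗g =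
    cong₂ _∷_ (f≗g 0 (s≤s z≤n)) (applyUpTo-cong n (λ k k<n → f≗g (suc k) (s≤s k<n)))

  applyUpTo-cong⁻¹ : ∀ {f g : ℕ → A} n → applyUpTo f n ≡ applyUpTo g n →
                     ∀ k → k < n → f k ≡ g k
  applyUpTo-cong⁻¹ (suc n) eq zero    _         = proj₁ (∷-injective eq)
  applyUpTo-cong⁻¹ (suc n) eq (suc k) (s≤s k<n) =
    applyUpTo-cong⁻¹ n (proj₂ (∷-injective eq)) k k<n

  -- The condition `suc (k + l) ≡ n` pairs the mirrored positions of a word of length `n` without
  -- subtraction.
  reverse-applyUpTo-mirror : ∀ {f g : ℕ → A} n → (∀ k l → suc (k + l) ≡ n → f k ≡ g l) →
                             reverse (applyUpTo f n) ≡ applyUpTo g n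
  reverse-applyUpTo-mirror {f} n mirror = trans (reverse-applyUpTo f n) (go n mirror)
    where
    go : ∀ {g : ℕ → A} n → (∀ k l → suc (k + l) ≡ n → f k ≡ g l) →
         applyDownFrom f n ≡ applyUpTo g n
    go zero    _      = refl
    go (suc n) mirror = cong₂ _∷_
      (mirror n 0 (cong suc (+-identityʳ n)))
      (go n (λ k l eq → mirror k (suc l) (cong suc (trans (+-suc k l) eq))))

  applyUpTo-+ : ∀ (f : ℕ → A) m n →
                applyUpTo f (m + n) ≡ applyUpTo f m ++ applyUpTo (λ k → f (m + k)) n
  applyUpTo-+ f zero    n = refl
  applyUpTo-+ f (suc m) n = cong (f 0 ∷_) (applyUpTo-+ (f ∘ suc) m n)

  infix-++ : ∀ p (v q : List A) → Infix _≡_ v (p ++ v ++ q)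
  infix-++ p v q = Infix.fromView (MkView p (Pointwise.≡⇒Pointwise-≡ refl) q)

  PalindromicFactor-reverse : ∀ {w v : List A} →
                              PalindromicFactor w v → PalindromicFactor (reverse w) v
  PalindromicFactor-reverse {v = v} (pal , inf) with Infix.toView inf
  ... | MkView p pw q with Pointwise.Pointwise-≡⇒≡ pw
  ... | refl = pal , subst (Infix _≡_ v) (sym eq) (infix-++ (reverse q) v (reverse p))
    where
    eq : reverse (p ++ v ++ q) ≡ reverse q ++ v ++ reverse p
    eq = begin
      reverse (p ++ v ++ q)                  ≡⟨ reverse-++ p (v ++ q) ⟩
      reverse (v ++ q) ++ reverse p          ≡⟨ cong (_++ reverse p) (reverse-++ v q) ⟩
      (reverse q ++ reverse v) ++ reverse p  ≡⟨ ++-assoc (reverse q) (reverse v) (reverse p) ⟩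
      reverse q ++ reverse v ++ reverse p    ≡⟨ cong (λ z → reverse q ++ z ++ reverse p) pal ⟩
      reverse q ++ v ++ reverse p            ∎
      where open ≡-Reasoning

  -- A word and its reversal have the same palindromic factors, so one list serves both.
  Rich-reverse : ∀ {w : List A} → Rich w → Rich (reverse w)
  Rich-reverse {w} (us , unique , complete , size) =
    us , unique , complete′ , trans size (cong suc (sym (length-reverse w)))
    where
    complete′ : ∀ u → u ∈ us ⇔ PalindromicFactor (reverse w) u
    complete′ u = mk⇔
      (PalindromicFactor-reverse ∘ Equivalence.to (complete u))
      (λ pf → Equivalence.from (complete u)
        (subst (λ z → PalindromicFactor z u) (reverse-involutive w)
               (PalindromicFactor-reverse pf)))

-- Blocks of an infinite word and their palindromes

module _ {A : Set} (W : ℕ → A) where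

  block-+ : ∀ i m n → block W i (m + n) ≡ block W i m ++ block W (i + m) n
  block-+ i m n = trans (applyUpTo-+ (λ k → W (i + k)) m n)
    (cong (block W i m ++_) (applyUpTo-cong n (λ k _ → cong W (sym (+-assoc i m k)))))

  length-block : ∀ i n → length (block W i n) ≡ n
  length-block i n = length-applyUpTo (λ k → W (i + k)) n

  block-factor : ∀ i n p v q → block W i n ≡ p ++ v ++ q →
                 length p + length v ≤ n × v ≡ block W (i + length p) (length v)
  block-factor i n p v q eq = le , sym (proj₁ v,q)
    where
    total : n ≡ length p + (length v + length q)
    total = begin
      n                              ≡⟨ length-block i n ⟨
      length (block W i n)           ≡⟨ cong length eq ⟩
      length (p ++ v ++ q)           ≡⟨ length-++ p ⟩
      length p + length (v ++ q)     ≡⟨ cong (length p +_) (length-++ v) ⟩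
      length p + (length v + length q) ∎
      where open ≡-Reasoning
    le : length p + length v ≤ n
    le = subst (length p + length v ≤_) (sym total) (+-monoʳ-≤ (length p) (m≤m+n _ _))
    p,vq = ++-injective {xs′ = p} (length-block i (length p))
      (trans (sym (block-+ i (length p) (length v + length q)))
             (trans (cong (block W i) (sym total)) eq))
    v,q = ++-injective {xs′ = v} (length-block (i + length p) (length v))
      (trans (sym (block-+ (i + length p) (length v) (length q))) (proj₂ p,vq))

  -- The position `r` is counted in `W`, not in the block, so that occurrences found in different
  -- blocks can be compared.
  infix⇒position : ∀ {i n v} → Infix _≡_ v (block W i n) →
                   ∃[ r ] i ≤ r × r + length v ≤ i + n × v ≡ block W r (length v)
  infix⇒position {i} {n} {v} inf = go (Infix.toView inf) refl
    where
    go : ∀ {w} → Infix.View _≡_ v w → block W i n ≡ w →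
         ∃[ r ] i ≤ r × r + length v ≤ i + n × v ≡ block W r (length v)
    go (MkView p pw q) eq with Pointwise.Pointwise-≡⇒≡ pw
    ... | refl with block-factor i n p v q eq
    ... | le , v≡ = i + length p , m≤m+n i _ ,
      subst (_≤ i + n) (sym (+-assoc i _ _)) (+-monoʳ-≤ i le) , v≡

  position⇒infix : ∀ {i n r l} → i ≤ r → r + l ≤ i + n →
                   Infix _≡_ (block W r l) (block W i n)
  position⇒infix {i} {n} {r} {l} i≤r r+l≤i+n
    with m≤n⇒∃[o]m+o≡n i≤r
  ... | d , refl with m≤n⇒∃[o]m+o≡n (+-cancelˡ-≤ i _ _ (subst (_≤ i + n) (+-assoc i d l) r+l≤i+n))
  ... | e , refl = subst (Infix _≡_ (block W r l)) (sym eq)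
          (infix-++ (block W i d) (block W (i + d) l) (block W (i + d + l) e))
    where
    eq : block W i (d + l + e) ≡ block W i d ++ block W (i + d) l ++ block W (i + d + l) e
    eq = trans (cong (block W i) (+-assoc d l e))
      (trans (block-+ i d (l + e)) (cong (block W i d ++_) (block-+ (i + d) l e)))

  -- Reversal turns the splitting after `m` letters into a splitting after `n` letters; comparing
  -- the first pieces gives the equality.
  palindrome-suffix : ∀ i m n → Palindrome (block W i (m + n)) →
                      reverse (block W (i + m) n) ≡ block W i n
  palindrome-suffix i m n pal = proj₁ (++-injective
    (trans (length-reverse (block W (i + m) n)) (trans (length-block (i + m) n) (sym (length-block i n))))
    (begin
      reverse (block W (i + m) n) ++ reverse (block W i m)
        ≡⟨ reverse-++ (block W i m) (block W (i + m) n) ⟨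
      reverse (block W i m ++ block W (i + m) n)
        ≡⟨ cong reverse (block-+ i m n) ⟨
      reverse (block W i (m + n))
        ≡⟨ pal ⟩
      block W i (m + n)
        ≡⟨ cong (block W i) (+-comm m n) ⟩
      block W i (n + m)
        ≡⟨ block-+ i n m ⟩
      block W i n ++ block W (i + n) m ∎))
    where open ≡-Reasoning

  -- The length `suc size-1` makes the palindrome nonempty. Newness refers to earlier starts in `W`
  -- itself, so it can be used in every block that ends at `N`.
  record NewPalindrome (N : ℕ) : Set where
    field
      start size-1 : ℕ
      end          : start + suc size-1 ≡ N
      palindrome   : Palindrome (block W start (suc size-1))
      isNew        : ∀ r → r < start → block W r (suc size-1) ≢ block W start (suc size-1)

  open NewPalindrome

  newPalindrome⇒unioccurrent : ∀ n → NewPalindrome (suc n) →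
                               HasUnioccurrentPalindromicSuffix (prefix W (suc n))
  newPalindrome⇒unioccurrent n new =
    u , (λ ()) , palindrome new ,
    subst (Suffix _≡_ u) (sym split)
      (Suffix.fromView (block W 0 b Suffix.++ Pointwise.≡⇒Pointwise-≡ refl)) ,
    b ,
    (block W 0 b , [] , trans split (cong (block W 0 b ++_) (sym (++-identityʳ u))) ,
     length-block 0 b) ,
    once
    where
    b = start new
    u = block W b (suc (size-1 new))
    split : block W 0 (suc n) ≡ block W 0 b ++ u
    split = trans (cong (block W 0) (sym (end new))) (block-+ 0 b _)
    once : ∀ {r} → OccursAt u (block W 0 (suc n)) r → b ≡ r
    once (p , q , eq , refl)
      with subst (λ l → length p + l ≤ suc n × u ≡ block W (length p) l) (length-block b _)
                 (block-factor 0 (suc n) p u q eq)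
    -- There is no room for an occurrence starting after `b`, and `isNew` excludes those starting
    -- before `b`.
    ... | le , u≡ with m≤n⇒m<n∨m≡n (+-cancelʳ-≤ _ (length p) b
      (subst (length p + suc (size-1 new) ≤_) (sym (end new)) le))
    ... | inj₁ r<b = contradiction (sym u≡) (isNew new _ r<b)
    ... | inj₂ r≡b = sym r≡b

  -- The appended letter creates exactly one palindrome, namely `u`. An occurrence of `u` in the
  -- shorter block would start before `b`. Every other palindromic suffix is longer than `u`, which
  -- is impossible, or shorter, and then it occurred already.
  rich-extend : ∀ i k (new : NewPalindrome (i + suc k)) → i ≤ start new →
                Rich (block W i k) → Rich (block W i (suc k))
  rich-extend i k new i≤b (us , unique , complete , size) =
    u ∷ us , tabulate fresh ∷ unique , (λ v → mk⇔ to from) ,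
    cong suc (trans size (trans (cong suc (length-block i k)) (sym (length-block i (suc k)))))
    where
    b = start new
    t = suc (size-1 new)
    u = block W b t
    i+k<b+t : i + k < b + t
    i+k<b+t = subst (i + k <_) (trans (sym (+-suc i k)) (sym (end new))) ≤-refl
    fresh : ∀ {v} → v ∈ us → u ≢ v
    fresh v∈us refl with infix⇒position (proj₂ (Equivalence.to (complete u) v∈us))
    ... | r , _ , pos
      with subst (λ l → r + l ≤ i + k × u ≡ block W r l) (length-block b t) pos
    ... | le , u≡ = isNew new r (+-cancelʳ-< t r b (≤-<-trans le i+k<b+t)) (sym u≡)
    to : ∀ {v} → v ∈ u ∷ us → PalindromicFactor (block W i (suc k)) v
    to (here refl)  = palindrome new , position⇒infix i≤b (≤-reflexive (end new))
    to {v} (there v∈us) with Equivalence.to (complete v) v∈us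
    ... | pal , inf with infix⇒position inf
    ... | r , i≤r , le , v≡ = pal ,
      subst (λ z → Infix _≡_ z (block W i (suc k))) (sym v≡)
        (position⇒infix i≤r (≤-trans le (+-monoʳ-≤ i (n≤1+n k))))
    old : ∀ {v r} → Palindrome v → i ≤ r → r + length v ≤ i + k → v ≡ block W r (length v) → v ∈ us
    old {v} pal i≤r le v≡ = Equivalence.from (complete v)
      (pal , subst (λ z → Infix _≡_ z (block W i k)) (sym v≡) (position⇒infix i≤r le))
    from : ∀ {v} → PalindromicFactor (block W i (suc k)) v → v ∈ u ∷ us
    from {v} (pal , inf) with infix⇒position inf
    ... | r , i≤r , le , v≡ with m≤n⇒m<n∨m≡n le
    ... | inj₁ lt = there (old pal i≤r (s≤s⁻¹ (subst (r + length v <_) (+-suc i k) lt)) v≡)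
    ... | inj₂ eq with <-cmp r b
    ... | tri≈ _ refl _ = here (trans v≡ (cong (block W b) (+-cancelˡ-≡ b _ _ (trans eq (sym (end new))))))
    -- Here `v` is longer and ends in `u`; being a palindrome, it also begins with the reversal of
    -- `u`, which is `u`, at `r < b`.
    ... | tri< r<b _ _ = contradiction (sym u≡) (isNew new r r<b)
      where
      u≡ : u ≡ block W r t
      u≡ with m≤n⇒∃[o]m+o≡n (<⇒≤ r<b)
      ... | d , refl = trans (sym (palindrome new)) (palindrome-suffix r d t
        (subst Palindrome (trans v≡ (cong (block W r) (+-cancelˡ-≡ r _ _
          (trans eq (trans (sym (end new)) (+-assoc r d t)))))) pal))
    -- Here `v` is a proper suffix of `u`; its mirror image in `u` starts at `b` and ends before the
    -- last letter.
    ... | tri> _ _ b<r = there (old pal i≤b (s≤s⁻¹ (subst₂ _<_ refl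
            (trans eq (+-suc i k)) (+-monoˡ-< _ b<r))) v≡′)
      where
      v≡′ : v ≡ block W b (length v)
      v≡′ with m≤n⇒∃[o]m+o≡n (<⇒≤ b<r)
      ... | d , refl = trans (trans (sym pal) (cong reverse v≡)) (palindrome-suffix b d (length v)
        (subst (Palindrome ∘ block W b) (+-cancelˡ-≡ b _ _
          (trans (end new) (trans (sym eq) (+-assoc b d _)))) (palindrome new)))

  -- The block is a suffix of the palindrome, so its reversal is the prefix of the palindrome with
  -- the same length, and richness survives reversal.
  rich-mirror : ∀ i k (new : NewPalindrome (i + k)) → start new ≤ i →
                Rich (block W (start new) k) → Rich (block W i k)
  rich-mirror i k new b≤i rich with m≤n⇒∃[o]m+o≡n b≤i
  ... | d , b+d≡i = subst Rich
    (trans (cong reverse (sym (palindrome-suffix b d k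
        (subst (Palindrome ∘ block W b) size≡ (palindrome new)))))
      (trans (reverse-involutive _) (cong (λ j → block W j k) b+d≡i)))
    (Rich-reverse rich)
    where
    b = start new
    size≡ : suc (size-1 new) ≡ d + k
    size≡ = +-cancelˡ-≡ b _ _
      (trans (end new) (trans (cong (_+ k) (sym b+d≡i)) (+-assoc b d k)))

  -- A block reaching further left than the new palindrome at its end is the
  -- mirror image of a block that ends earlier.
  newPalindromes⇒Rich∞ : (∀ n → NewPalindrome (suc n)) → Rich∞ W
  -- The induction is on the end position `i + n`, because mirroring keeps the length of a block and
  -- lowers its end.
  newPalindromes⇒Rich∞ new i n = <-rec (λ N → ∀ i n → i + n ≡ N → Rich (block W i n)) step
    (i + n) i n refl
    where
    step : ∀ N → (∀ {M} → M < N → ∀ i n → i + n ≡ M → Rich (block W i n)) →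
           ∀ i n → i + n ≡ N → Rich (block W i n)
    step _ rec i zero _ = ([] ∷ []) , (All.[] ∷ []) , complete , refl
      where
      complete : ∀ u → u ∈ [] ∷ [] ⇔ PalindromicFactor [] u
      complete u = mk⇔ (λ { (here refl) → refl , infix-++ [] [] [] })
        (λ { (_ , Infix.here Prefix.[]) → here refl })
    step _ rec i (suc k) refl with subst NewPalindrome (sym (+-suc i k)) (new (i + k))
    ... | nw with ≤-<-connex i (start nw)
    ... | inj₁ i≤b = rich-extend i k nw i≤b (rec (subst (i + k <_) (sym (+-suc i k)) ≤-refl) i k refl)
    -- The palindrome starts strictly to the left of the block, so the mirrored block, starting at
    -- `start nw`, ends strictly earlier.
    ... | inj₂ b<i = rich-mirror i (suc k) nw (<⇒≤ b<i)
                       (rec (+-monoˡ-< (suc k) b<i) (start nw) (suc k) refl)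

-- Translation-invariant enumerations of ℕ²

Point : Set
Point = ℕ × ℕ

infixl 6 _⊕_

_⊕_ : Point → Point → Point
(i , j) ⊕ (k , l) = i + k , j + l

⊕-comm : ∀ x y → x ⊕ y ≡ y ⊕ x
⊕-comm (i , j) (k , l) = cong₂ _,_ (+-comm i k) (+-comm j l)

⊕-∸ : ∀ {i j k l} → i ≤ k → j ≤ l → (i , j) ⊕ (k ∸ i , l ∸ j) ≡ (k , l)
⊕-∸ i≤k j≤l = cong₂ _,_ (m+[n∸m]≡n i≤k) (m+[n∸m]≡n j≤l)

-- In ℤ² this says that the difference of `x` and `y` is unchanged when both advance by the same
-- vector, to `x′` and `y′`. Sums replace differences because coordinates are natural numbers.
telescope : ∀ x x′ y y′ z w → x′ ⊕ y ≡ y′ ⊕ x → x ⊕ z ≡ w ⊕ y → x′ ⊕ z ≡ w ⊕ y′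
telescope (x₁ , x₂) (x₁′ , x₂′) (y₁ , y₂) (y₁′ , y₂′) (z₁ , z₂) (w₁ , w₂) eq₁ eq₂ = cong₂ _,_
  (go x₁ x₁′ y₁ y₁′ z₁ w₁ (cong proj₁ eq₁) (cong proj₁ eq₂))
  (go x₂ x₂′ y₂ y₂′ z₂ w₂ (cong proj₂ eq₁) (cong proj₂ eq₂))
  where
  open ℕ.+-*-Solver
  go : ∀ x x′ y y′ z w → x′ + y ≡ y′ + x → x + z ≡ w + y → x′ + z ≡ w + y′
  go x x′ y y′ z w eq₁ eq₂ = +-cancelʳ-≡ (x + y) _ _ (trans
    (solve 4 (λ x x′ y z → (x′ :+ z) :+ (x :+ y) := (x′ :+ y) :+ (x :+ z)) refl x x′ y z)
    (trans (cong₂ _+_ eq₁ eq₂)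
      (solve 4 (λ x y y′ w → (y′ :+ x) :+ (w :+ y) := (w :+ y′) :+ (x :+ y)) refl x y y′ w)))

≤-suc-elim : ∀ (P : ℕ → Set) {N} → (∀ k → k ≤ N → P k) → P (suc N) → ∀ k → k ≤ suc N → P k
≤-suc-elim P below last k k≤ with m≤n⇒m<n∨m≡n k≤
... | inj₁ (s≤s k≤N) = below k k≤N
... | inj₂ refl      = last

argmax : ∀ (f : ℕ → ℕ) N → ∃[ k ] k ≤ N × ∀ k′ → k′ ≤ N → f k′ ≤ f k
argmax f zero = 0 , z≤n , λ { zero _ → ≤-refl }
argmax f (suc N) with argmax f N
... | k , k≤N , max with ≤-total (f k) (f (suc N))
... | inj₁ le = suc N , ≤-refl ,
  ≤-suc-elim (λ k′ → f k′ ≤ f (suc N)) (λ k′ k′≤N → ≤-trans (max k′ k′≤N) le) ≤-refl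
... | inj₂ ge = k , m≤n⇒m≤1+n k≤N , ≤-suc-elim (λ k′ → f k′ ≤ f k) max ge

-- What the combinatorial argument retains of S(θ): a bijection of ℕ with ℕ² whose order is
-- preserved by translation. The real numbers enter only when an instance is built.
record Enumeration : Set where
  field
    pt       : ℕ → Point
    idx      : Point → ℕ
    idx-pt   : ∀ n → idx (pt n) ≡ n
    pt-idx   : ∀ x → pt (idx x) ≡ x
    idx-mono : ∀ x y z → idx x < idx y → idx (x ⊕ z) < idx (y ⊕ z)

module _ (E : Enumeration) where
  open Enumeration E

  idx-mono-≤ : ∀ x y z → idx x ≤ idx y → idx (x ⊕ z) ≤ idx (y ⊕ z)
  idx-mono-≤ x y z le with m≤n⇒m<n∨m≡n le
  ... | inj₁ lt = <⇒≤ (idx-mono x y z lt)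
  ... | inj₂ eq = ≤-reflexive (cong (λ p → idx (p ⊕ z))
                    (trans (sym (pt-idx x)) (trans (cong pt eq) (pt-idx y))))

  idx-mono-<-≤ : ∀ {x y z w} → idx x < idx y → idx z ≤ idx w → idx (x ⊕ z) < idx (y ⊕ w)
  idx-mono-<-≤ {x} {y} {z} {w} lt le = <-≤-trans (idx-mono x y z lt)
    (subst₂ (λ p q → idx p ≤ idx q) (⊕-comm z y) (⊕-comm w y) (idx-mono-≤ z w y le))

  -- The map `x ↦ c − x` reverses the order, stated without subtraction: if both summands on one
  -- side were larger, one of them strictly, the sums would differ.
  balance : ∀ {x y z w} → x ⊕ y ≡ z ⊕ w → idx w ≤ idx y → idx x ≤ idx z
  balance eq le = ≮⇒≥ λ lt → <-irrefl (cong idx (sym eq)) (idx-mono-<-≤ lt le)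

  balance-< : ∀ {x y z w} → x ⊕ y ≡ z ⊕ w → idx w < idx y → idx x < idx z
  balance-< {x} {y} {z} {w} eq lt = ≰⇒> λ le →
    <-irrefl (cong idx (trans (⊕-comm w z) (trans (sym eq) (⊕-comm x y)))) (idx-mono-<-≤ lt le)

  -- Translating repeatedly by a point below the origin would descend forever.
  idx-origin : ∀ z → idx (0 , 0) ≤ idx z
  idx-origin z = ≮⇒≥ λ lt → <-rec (λ n → ∀ x → idx x ≡ n → ⊥)
    (λ { _ rec x refl → rec (idx-mono z (0 , 0) x lt) (z ⊕ x) refl }) (idx z) z refl

  idx-⊕ : ∀ x z → idx x ≤ idx (x ⊕ z)
  idx-⊕ x z = subst (λ p → idx x ≤ idx p) (⊕-comm z x) (idx-mono-≤ (0 , 0) z x (idx-origin z))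

  balance-pt : ∀ {k l r s} → pt k ⊕ pt r ≡ pt l ⊕ pt s → s ≤ r → k ≤ l
  balance-pt {k} {l} {r} {s} eq le = subst₂ _≤_ (idx-pt k) (idx-pt l)
    (balance eq (subst₂ _≤_ (sym (idx-pt s)) (sym (idx-pt r)) le))

  balance-pt-< : ∀ {k l r s} → pt k ⊕ pt r ≡ pt l ⊕ pt s → s < r → k < l
  balance-pt-< {k} {l} {r} {s} eq lt = subst₂ _<_ (idx-pt k) (idx-pt l)
    (balance-< eq (subst₂ _<_ (sym (idx-pt s)) (sym (idx-pt r)) lt))

  -- The cross sums in `letter` express equality of two steps in ℤ².
  module _ {A : Set} (W : ℕ → A)
    (letter : ∀ m n → W m ≡ W n ⇔ pt (suc m) ⊕ pt n ≡ pt (suc n) ⊕ pt m) where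

    -- Equal letters are equal steps, and adding these up shows that the points under the two
    -- occurrences differ by a constant vector.
    translate : ∀ {r b} n → block W r n ≡ block W b n → ∀ k → k ≤ n →
                pt (r + k) ⊕ pt b ≡ pt r ⊕ pt (b + k)
    translate {r} {b} n eq zero _ =
      cong₂ (λ p q → pt p ⊕ pt q) (+-identityʳ r) (sym (+-identityʳ b))
    translate {r} {b} n eq (suc k) k<n =
      subst₂ (λ p q → pt p ⊕ pt b ≡ pt r ⊕ pt q) (sym (+-suc r k)) (sym (+-suc b k))
        (telescope (pt (r + k)) (pt (suc (r + k))) (pt (b + k)) (pt (suc (b + k))) (pt b) (pt r)
          (Equivalence.to (letter (r + k) (b + k)) (applyUpTo-cong⁻¹ n eq k k<n))
                   (translate n eq k (<⇒≤ k<n)))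

    -- The reflection and the new palindromic suffix

    module _ (n : ℕ) where
      private
        N = suc n
        maxᵢ = argmax (proj₁ ∘ pt) N
        maxⱼ = argmax (proj₂ ∘ pt) N
        m = proj₁ (pt (proj₁ maxᵢ))
        l = proj₂ (pt (proj₁ maxⱼ))

        -- The point attaining the maximum `m` is `(m , 0)` plus a point of ℕ², and adding a point
        -- never lowers the index.
        M≤N : idx (m , 0) ≤ N
        M≤N = ≤-trans (subst₂ _≤_ refl
          (trans (cong (λ i → idx (i , proj₂ (pt (proj₁ maxᵢ)))) (+-identityʳ m)) (idx-pt _))
          (idx-⊕ (m , 0) (0 , _))) (proj₁ (proj₂ maxᵢ))

        L≤N : idx (0 , l) ≤ N
        L≤N = ≤-trans (subst₂ _≤_ refl
          (trans (cong (λ j → idx (proj₁ (pt (proj₁ maxⱼ)) , j)) (+-identityʳ l)) (idx-pt _))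
          (idx-⊕ (0 , l) (_ , 0))) (proj₁ (proj₂ maxⱼ))

        -- The index of `c − s_k`. For `k ≤ N` the truncated subtractions are exact, since `m` and
        -- `l` are maxima.
        ρ : ℕ → ℕ
        ρ k = idx (m ∸ proj₁ (pt k) , l ∸ proj₂ (pt k))

        centre : ∀ {k} → k ≤ N → pt k ⊕ pt (ρ k) ≡ (m , l)
        centre {k} k≤N = trans (cong (pt k ⊕_) (pt-idx _))
          (⊕-∸ (proj₂ (proj₂ maxᵢ) k k≤N) (proj₂ (proj₂ maxⱼ) k k≤N))

        centre′ : ∀ {k} → k ≤ N → pt (ρ k) ⊕ pt k ≡ (m , l)
        centre′ {k} k≤N = trans (⊕-comm (pt (ρ k)) (pt k)) (centre k≤N)

        b = ρ N

        -- Both `pt b ⊕ pt N` and `(m , 0) ⊕ (0 , l)` equal the centre, and `(0 , l)` lies at or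
        -- below `pt N`.
        b≤M : b ≤ idx (m , 0)
        b≤M = balance-pt {r = N} {s = idx (0 , l)} (trans (centre′ ≤-refl)
          (sym (trans (cong₂ _⊕_ (pt-idx _) (pt-idx _)) (cong (_, l) (+-identityʳ m))))) L≤N

        b≤L : b ≤ idx (0 , l)
        b≤L = balance-pt {r = N} {s = idx (m , 0)} (trans (centre′ ≤-refl)
          (sym (trans (cong₂ _⊕_ (pt-idx _) (pt-idx _)) (cong (m ,_) (+-identityʳ l))))) M≤N

        b≤N : b ≤ N
        b≤N = ≤-trans b≤M M≤N

        -- This makes the palindrome nonempty. If `b` were `N`, then `(m , 0)` and `(0 , l)` would
        -- both be squeezed to index `N`; they would coincide at the origin, and `N` would be 0.
        b≢N : b ≢ N
        b≢N b≡N = n≮0 (≤-trans (≤-reflexive (trans (sym b≡N) (trans b≡M (cong (λ i → idx (i , 0)) m≡0))))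
                        (subst (idx (0 , 0) ≤_) (idx-pt 0) (idx-origin (pt 0))))
          where
          b≡M : b ≡ idx (m , 0)
          b≡M = ≤-antisym b≤M (subst (idx (m , 0) ≤_) (sym b≡N) M≤N)
          b≡L : b ≡ idx (0 , l)
          b≡L = ≤-antisym b≤L (subst (idx (0 , l) ≤_) (sym b≡N) L≤N)
          m≡0 : m ≡ 0
          m≡0 = cong proj₁ (trans (sym (pt-idx (m , 0)))
                  (trans (cong pt (trans (sym b≡M) b≡L)) (pt-idx (0 , l))))

        ρ≤N : ∀ {k} → b ≤ k → k ≤ N → ρ k ≤ N
        ρ≤N {k} b≤k k≤N = balance-pt (trans (centre′ k≤N) (sym (centre ≤-refl))) b≤k

        ρ-b : ρ b ≡ N
        ρ-b = ≤-antisym (ρ≤N ≤-refl b≤N)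
          (balance-pt (trans (centre ≤-refl) (sym (centre′ b≤N))) ≤-refl)

        ρ-suc : ∀ {k} → b ≤ k → suc k ≤ N → ρ k ≡ suc (ρ (suc k))
        ρ-suc {k} b≤k k<N with m≤n⇒m<n∨m≡n ρ′<ρ
          where
          ρ′<ρ : ρ (suc k) < ρ k
          ρ′<ρ = balance-pt-< (trans (centre′ k<N) (sym (centre′ (<⇒≤ k<N)))) ≤-refl
        ... | inj₂ eq = sym eq
        -- An index `x` strictly between `ρ (suc k)` and `ρ k` would have its mirror image strictly
        -- between `k` and `suc k`.
        ... | inj₁ x<ρk = contradiction
          (balance-pt-< (trans (centre′ x≤N) (sym (centre k<N))) ≤-refl)
          (≤⇒≯ (balance-pt-< (trans (centre (<⇒≤ k<N)) (sym (centre′ x≤N))) x<ρk))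
          where
          x≤N : suc (ρ (suc k)) ≤ N
          x≤N = ≤-trans (<⇒≤ x<ρk) (ρ≤N b≤k (<⇒≤ k<N))

        -- Starting from `ρ b ≡ N`, each step lowers `ρ` by one, so on the interval from `b` to `N`
        -- it is the reflection exchanging the ends.
        ρ-+ : ∀ k → b + k ≤ N → k + ρ (b + k) ≡ N
        ρ-+ zero    _  = trans (cong ρ (+-identityʳ b)) ρ-b
        ρ-+ (suc k) le = begin
          suc k + ρ (b + suc k)   ≡⟨ +-suc k _ ⟨
          k + suc (ρ (b + suc k)) ≡⟨ cong (λ z → k + suc (ρ z)) (+-suc b k) ⟩
          k + suc (ρ (suc (b + k))) ≡⟨ cong (k +_) (ρ-suc (m≤m+n b k) le′) ⟨
          k + ρ (b + k)           ≡⟨ ρ-+ k (<⇒≤ le′) ⟩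
          N                       ∎
          where
          open ≡-Reasoning
          le′ : suc (b + k) ≤ N
          le′ = subst (_≤ N) (+-suc b k) le

        -- The reflection exchanges the endpoints of the two steps, so both cross sums in `letter`
        -- equal the centre.
        W-mirror : ∀ k r → suc (b + k + r) ≡ N → W (b + k) ≡ W (b + r)
        W-mirror k r eq = Equivalence.from (letter (b + k) (b + r)) (begin
          pt (suc (b + k)) ⊕ pt (b + r)         ≡⟨ cong (λ z → pt (suc (b + k)) ⊕ pt z) ρ≡ ⟨
          pt (suc (b + k)) ⊕ pt (ρ (suc (b + k))) ≡⟨ centre le ⟩
          (m , l)                               ≡⟨ centre′ (<⇒≤ le) ⟨
          pt (ρ (b + k)) ⊕ pt (b + k)
            ≡⟨ cong (λ z → pt z ⊕ pt (b + k)) (trans (ρ-suc (m≤m+n b k) le) (cong suc ρ≡)) ⟩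
          pt (suc (b + r)) ⊕ pt (b + k)         ∎)
          where
          open ≡-Reasoning
          le : suc (b + k) ≤ N
          le = subst (suc (b + k) ≤_) eq (m≤m+n _ r)
          ρ≡ : ρ (suc (b + k)) ≡ b + r
          ρ≡ = +-cancelˡ-≡ (suc k) _ _ (begin
            suc k + ρ (suc (b + k)) ≡⟨ cong (λ z → suc k + ρ z) (+-suc b k) ⟨
            suc k + ρ (b + suc k)   ≡⟨ ρ-+ (suc k) (subst (_≤ N) (sym (+-suc b k)) le) ⟩
            N                       ≡⟨ eq ⟨
            suc (b + k + r)         ≡⟨ cong (λ z → suc (z + r)) (+-comm b k) ⟩
            suc (k + b + r)         ≡⟨ cong suc (+-assoc k b r) ⟩
            suc k + (b + r)         ∎)

        -- The interval contains an integer and a multiple of θ, so a copy of it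
        -- cannot be shifted down in either coordinate.
        no-earlier : ∀ t → b + t ≡ N → ∀ r → r < b → block W r t ≢ block W b t
        no-earlier t b+t≡N r r<b eq = <⇒≱ r<b
          -- Once both coordinates of `pt b` are bounded by those of `pt r`, the latter is `pt b`
          -- plus a point, whence `b ≤ r`.
          (subst₂ _≤_ (idx-pt b)
             (trans (cong idx (⊕-∸ first≤ second≤))
                    (idx-pt r))
             (idx-⊕ (pt b) (proj₁ (pt r) ∸ proj₁ (pt b) , proj₂ (pt r) ∸ proj₂ (pt b))))
          where
          shift : ∀ {x} → b ≤ idx x → idx x ≤ N → ∃[ y ] y ⊕ pt b ≡ pt r ⊕ x
          shift {x} b≤x x≤N with m≤n⇒∃[o]m+o≡n b≤x
          ... | k , b+k≡x = pt (r + k) , trans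
            (translate t eq k (+-cancelˡ-≤ b k t (subst₂ _≤_ (sym b+k≡x) (sym b+t≡N) x≤N)))
            (cong (pt r ⊕_) (trans (cong pt b+k≡x) (pt-idx x)))
          first≤ : proj₁ (pt b) ≤ proj₁ (pt r)
          first≤ with shift b≤L L≤N
          ... | y , eq′ = subst (proj₁ (pt b) ≤_) (trans (cong proj₁ eq′) (+-identityʳ _)) (m≤n+m _ (proj₁ y))
          second≤ : proj₂ (pt b) ≤ proj₂ (pt r)
          second≤ with shift b≤M M≤N
          ... | y , eq′ = subst (proj₂ (pt b) ≤_) (trans (cong proj₂ eq′) (+-identityʳ _)) (m≤n+m _ (proj₂ y))

      newPalindrome : NewPalindrome W N
      newPalindrome with m≤n⇒∃[o]m+o≡n (≤∧≢⇒< b≤N b≢N)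
      ... | t , eq = record
        { start      = b
        ; size-1     = t
        ; end        = end
        ; palindrome = reverse-applyUpTo-mirror (suc t) λ k r k+r≡t → W-mirror k r
            (trans (cong suc (+-assoc b k r)) (trans (sym (+-suc b (k + r))) (trans (cong (b +_) k+r≡t) end)))
        ; isNew      = no-earlier (suc t) end
        }
        where
        end : b + suc t ≡ N
        end = trans (+-suc b t) eq

-- Real numbers

open import Data.Integer.Base using (+_)
open +-*-Solver using (solve; _:+_; _:-_; _:*_; :-_; _:=_; con)

-- Order depends only on the difference, which reduces many inequalities below to ring identities.
<-by-difference : ∀ {p q r s} → q ℚ.- p ≡ s ℚ.- r → p ℚ.< q → r ℚ.< s
<-by-difference {p} {q} {r} {s} eq p<q = subst₂ ℚ._<_
  (solve 2 (λ p r → p :+ (r :- p) := r) refl p r)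
  (trans (solve 3 (λ p q r → q :+ (r :- p) := (q :- p) :+ r) refl p q r)
    (trans (cong (ℚ._+ r) eq) (solve 2 (λ r s → (s :- r) :+ r := s) refl r s)))
  (ℚ.+-monoˡ-< (r ℚ.- p) p<q)

p≤∣p∣ : ∀ p → p ℚ.≤ ∣ p ∣
p≤∣p∣ p with ℚ.≤-total 0ℚ p
... | inj₁ 0≤p = ℚ.≤-reflexive (sym (ℚ.0≤p⇒∣p∣≡p 0≤p))
... | inj₂ p≤0 = ℚ.≤-trans p≤0 (ℚ.0≤∣p∣ p)

-p≤∣p∣ : ∀ p → ℚ.- p ℚ.≤ ∣ p ∣
-p≤∣p∣ p = subst (ℚ.- p ℚ.≤_) (ℚ.∣-p∣≡∣p∣ p) (p≤∣p∣ (ℚ.- p))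

∣p-q∣≡∣q-p∣ : ∀ p q → ∣ p ℚ.- q ∣ ≡ ∣ q ℚ.- p ∣
∣p-q∣≡∣q-p∣ p q = trans (sym (ℚ.∣-p∣≡∣p∣ (p ℚ.- q)))
  (cong ∣_∣ (solve 2 (λ p q → :- (p :- q) := q :- p) refl p q))

0<½* : ∀ {ε} → 0ℚ ℚ.< ε → 0ℚ ℚ.< ½ ℚ.* ε
0<½* {ε} 0<ε = subst (ℚ._< ½ ℚ.* ε) (ℚ.*-zeroʳ ½) (ℚ.*-monoʳ-<-pos ½ 0<ε)

½*+½* : ∀ ε → ½ ℚ.* ε ℚ.+ ½ ℚ.* ε ≡ ε
½*+½* = solve 1 (λ ε → con ½ :* ε :+ con ½ :* ε := ε) refl

≃-by-difference : ∀ x y z w → (∀ n → seq x n ℚ.- seq y n ≡ seq z n ℚ.- seq w n) →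
                  x ≃ y → z ≃ w
≃-by-difference x y z w eq x≃y ε 0<ε with x≃y ε 0<ε
... | N , close = N , λ n N≤n → subst (λ p → ∣ p ∣ ℚ.< ε) (eq n) (close n N≤n)

≃-pointwise : ∀ x y → (∀ n → seq x n ≡ seq y n) → x ≃ y
≃-pointwise x y eq = ≃-by-difference x x x y (λ n → cong (λ p → seq x n ℚ.- p) (eq n)) (≃-refl {x})

≃-sym : ∀ x y → x ≃ y → y ≃ x
≃-sym x y x≃y ε 0<ε with x≃y ε 0<ε
... | N , close = N , λ n N≤n → subst (ℚ._< ε) (∣p-q∣≡∣q-p∣ (seq x n) (seq y n)) (close n N≤n)

+ʳ-cong : ∀ x x′ y y′ → x ≃ x′ → y ≃ y′ → x +ʳ y ≃ x′ +ʳ y′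
+ʳ-cong x x′ y y′ x≃x′ y≃y′ ε 0<ε with x≃x′ _ (0<½* 0<ε) | y≃y′ _ (0<½* 0<ε)
... | M , close-x | N , close-y = M ⊔ N , λ n le → begin-strict
  ∣ (seq x n ℚ.+ seq y n) ℚ.- (seq x′ n ℚ.+ seq y′ n) ∣
    ≡⟨ cong ∣_∣ (solve 4 (λ x x′ y y′ → (x :+ y) :- (x′ :+ y′) := (x :- x′) :+ (y :- y′))
                  refl (seq x n) (seq x′ n) (seq y n) (seq y′ n)) ⟩
  ∣ (seq x n ℚ.- seq x′ n) ℚ.+ (seq y n ℚ.- seq y′ n) ∣
    ≤⟨ ℚ.∣p+q∣≤∣p∣+∣q∣ (seq x n ℚ.- seq x′ n) (seq y n ℚ.- seq y′ n) ⟩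
  ∣ seq x n ℚ.- seq x′ n ∣ ℚ.+ ∣ seq y n ℚ.- seq y′ n ∣
    <⟨ ℚ.+-mono-< (close-x n (m⊔n≤o⇒m≤o M N le)) (close-y n (m⊔n≤o⇒n≤o M N le)) ⟩
  ½ ℚ.* ε ℚ.+ ½ ℚ.* ε
    ≡⟨ ½*+½* ε ⟩
  ε ∎
  where open ℚ.≤-Reasoning

-- Add the two equations and cancel `y`.
≃-trans : ∀ x y z → x ≃ y → y ≃ z → x ≃ z
≃-trans x y z x≃y y≃z = ≃-by-difference (x +ʳ y) (y +ʳ z) x z
  (λ n → solve 3 (λ x y z → (x :+ y) :- (y :+ z) := x :- z) refl (seq x n) (seq y n) (seq z n))
  (+ʳ-cong x y y z x≃y y≃z)

<ʳ-by-difference : ∀ x y z w → (∀ n → seq y n ℚ.- seq x n ≡ seq w n ℚ.- seq z n) →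
                   x <ʳ y → z <ʳ w
<ʳ-by-difference x y z w eq (ε , 0<ε , N , lt) = ε , 0<ε , N , λ n N≤n →
  <-by-difference (begin
    seq y n ℚ.- (seq x n ℚ.+ ε) ≡⟨ regroup (seq y n) (seq x n) ε ⟩
    seq y n ℚ.- seq x n ℚ.- ε   ≡⟨ cong (ℚ._- ε) (eq n) ⟩
    seq w n ℚ.- seq z n ℚ.- ε   ≡⟨ regroup (seq w n) (seq z n) ε ⟨
    seq w n ℚ.- (seq z n ℚ.+ ε) ∎) (lt n N≤n)
  where
  open ≡-Reasoning
  regroup : ∀ p q ε → p ℚ.- (q ℚ.+ ε) ≡ p ℚ.- q ℚ.- ε
  regroup = solve 3 (λ p q ε → p :- (q :+ ε) := p :- q :- ε) refl

<ʳ-trans : ∀ x y z → x <ʳ y → y <ʳ z → x <ʳ z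
<ʳ-trans x y z (ε , 0<ε , M , x<y) (η , 0<η , N , y<z) = ε , 0<ε , M ⊔ N , λ n le →
  ℚ.<-trans (x<y n (m⊔n≤o⇒m≤o M N le))
    (ℚ.<-trans
      (<-by-difference
        (solve 2 (λ y η → η :- con 0ℚ := (y :+ η) :- y) refl (seq y n) η) 0<η)
      (y<z n (m⊔n≤o⇒n≤o M N le)))

<ʳ-respˡ-≃ : ∀ x x′ y → x ≃ x′ → x <ʳ y → x′ <ʳ y
<ʳ-respˡ-≃ x x′ y x≃x′ (ε , 0<ε , M , x<y) with x≃x′ _ (0<½* 0<ε)
-- Half of the margin `ε` pays for replacing `x` by `x′`.
... | N , close = ½ ℚ.* ε , 0<½* 0<ε , M ⊔ N , λ n le → <-by-difference
  (solve 4 (λ x x′ y ε → (y :+ con ½ :* ε) :- ((x :+ ε) :+ (:- (x :- x′))) := y :- (x′ :+ con ½ :* ε))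
    refl (seq x n) (seq x′ n) (seq y n) ε)
  (ℚ.+-mono-< (x<y n (m⊔n≤o⇒m≤o M N le))
              (ℚ.≤-<-trans (-p≤∣p∣ (seq x n ℚ.- seq x′ n)) (close n (m⊔n≤o⇒n≤o M N le))))

<ʳ-respʳ-≃ : ∀ x y y′ → y ≃ y′ → x <ʳ y → x <ʳ y′
<ʳ-respʳ-≃ x y y′ y≃y′ (ε , 0<ε , M , x<y) with y≃y′ _ (0<½* 0<ε)
... | N , close = ½ ℚ.* ε , 0<½* 0<ε , M ⊔ N , λ n le → <-by-difference
  (solve 4 (λ x y y′ ε → (y :+ con ½ :* ε) :- ((x :+ ε) :+ (y :- y′)) := y′ :- (x :+ con ½ :* ε))
    refl (seq x n) (seq y n) (seq y′ n) ε)
  (ℚ.+-mono-< (x<y n (m⊔n≤o⇒m≤o M N le))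
              (ℚ.≤-<-trans (p≤∣p∣ (seq y n ℚ.- seq y′ n)) (close n (m⊔n≤o⇒n≤o M N le))))

<ʳ-irrefl : ∀ x y → x ≃ y → ¬ (x <ʳ y)
<ʳ-irrefl x y x≃y (ε , 0<ε , M , x<y) with x≃y ε 0<ε
... | N , close = ℚ.<-irrefl {ε} refl (<-by-difference
  (solve 3 (λ x y ε → (y :+ ε) :- ((x :+ ε) :+ (:- (x :- y))) := ε :- ε)
    refl (seq x n) (seq y n) ε)
  (ℚ.+-mono-< (x<y n (m≤m⊔n M N))
              (ℚ.≤-<-trans (-p≤∣p∣ (seq x n ℚ.- seq y n)) (close n (m≤n⊔m M N)))))
  where n = M ⊔ N

-- Division of a linear relation by a positive coefficient: tolerance `D * ε` for `x` and `y` is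
-- tolerance `ε` for `z` and `w`.
scaled-difference⇒≃ : ∀ x y z w D .{{_ : ℚ.Positive D}} →
                      (∀ n → seq x n ℚ.- seq y n ≡ D ℚ.* (seq z n ℚ.- seq w n)) → x ≃ y → z ≃ w
scaled-difference⇒≃ x y z w D scaled x≃y ε 0<ε
  with x≃y (D ℚ.* ε) (subst (ℚ._< D ℚ.* ε) (ℚ.*-zeroʳ D) (ℚ.*-monoʳ-<-pos D 0<ε))
... | N , close = N , λ n N≤n → ℚ.*-cancelˡ-<-nonNeg D {{ℚ.pos⇒nonNeg D}}
  (subst (ℚ._< D ℚ.* ε)
    (trans (cong ∣_∣ (scaled n))
      (trans (ℚ.∣p*q∣≡∣p∣*∣q∣ D (seq z n ℚ.- seq w n))
        (cong (ℚ._* ∣ seq z n ℚ.- seq w n ∣) (ℚ.0≤p⇒∣p∣≡p (ℚ.<⇒≤ (ℚ.positive⁻¹ D))))))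
    (close n N≤n))

constant-difference⇒≄ : ∀ x y D → 0ℚ ℚ.< D → (∀ n → seq y n ℚ.- seq x n ≡ D) → ¬ (x ≃ y)
constant-difference⇒≄ x y D 0<D diff x≃y with x≃y D 0<D
... | N , close = ℚ.<-irrefl {D} refl (subst (ℚ._< D)
  (trans (∣p-q∣≡∣q-p∣ (seq x N) (seq y N))
    (trans (cong ∣_∣ (diff N)) (ℚ.0≤p⇒∣p∣≡p (ℚ.<⇒≤ 0<D))))
  (close N ≤-refl))

-- Rational addition normalises its result, so the identity is checked on unnormalised fractions.
/1-+ : ∀ m n → + (m + n) ℚ./ 1 ≡ (+ m ℚ./ 1) ℚ.+ (+ n ℚ./ 1)
/1-+ m n = ℚ.toℚᵘ-injective (begin-equality
  ℚ.toℚᵘ (+ (m + n) ℚ./ 1)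
    ≃⟨ ℚ.toℚᵘ-fromℚᵘ (ℚᵘ.mkℚᵘ (+ (m + n)) 0) ⟩
  ℚᵘ.mkℚᵘ (+ (m + n)) 0
    ≃⟨ ℚᵘ.*≡* (cong (ℤ._* (+ 1)) (cong₂ ℤ._+_ (sym (ℤ.*-identityʳ (+ m))) (sym (ℤ.*-identityʳ (+ n))))) ⟩
  ℚᵘ.mkℚᵘ (+ m) 0 ℚᵘ.+ ℚᵘ.mkℚᵘ (+ n) 0
    ≃⟨ ℚᵘ.+-cong (ℚ.toℚᵘ-fromℚᵘ (ℚᵘ.mkℚᵘ (+ m) 0)) (ℚ.toℚᵘ-fromℚᵘ (ℚᵘ.mkℚᵘ (+ n) 0)) ⟨
  ℚ.toℚᵘ (+ m ℚ./ 1) ℚᵘ.+ ℚ.toℚᵘ (+ n ℚ./ 1)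
    ≃⟨ ℚ.toℚᵘ-homo-+ (+ m ℚ./ 1) (+ n ℚ./ 1) ⟨
  ℚ.toℚᵘ ((+ m ℚ./ 1) ℚ.+ (+ n ℚ./ 1)) ∎)
  where open ℚᵘ.≤-Reasoning

0/1 : + 0 ℚ./ 1 ≡ 0ℚ
0/1 = refl

suc/1 : ∀ n → + suc n ℚ./ 1 ≡ 1ℚ ℚ.+ (+ n ℚ./ 1)
suc/1 n = trans (/1-+ 1 n) (cong (ℚ._+ (+ n ℚ./ 1)) 1/1)
  where
  1/1 : + 1 ℚ./ 1 ≡ 1ℚ
  1/1 = refl

-- Labels by first occurrence

module _ (d : ℕ → ℝ) (_≃?_ : ∀ m n → Dec (d m ≃ d n)) where

  firstOccurrence : ∀ n → ∃[ p ] IsNew d p × d p ≃ d n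
  firstOccurrence = <-rec _ step
    where
    step : ∀ n → (∀ {m} → m < n → ∃[ p ] IsNew d p × d p ≃ d m) → ∃[ p ] IsNew d p × d p ≃ d n
    step n rec with anyUpTo? (_≃? n) n
    ... | no none = n , (λ k k<n eq → none (k , k<n , eq)) , ≃-refl {d n}
    ... | yes (m , m<n , eq) with rec m<n
    ... | p , new , eq′ = p , new , ≃-trans (d p) (d m) (d n) eq′ eq

  -- The absence of new positions after `p` is carried along because `next` asks for it when the
  -- following new position is found.
  lastNew : ∀ n → ∃[ m ] ∃[ p ] NthNew d m p × p ≤ n × (∀ k → p < k → k ≤ n → ¬ IsNew d k)
  lastNew zero = 0 , 0 , first , z≤n , λ k 0<k k≤0 _ → <⇒≱ 0<k k≤0
  lastNew (suc n) with lastNew n | anyUpTo? (_≃? suc n) (suc n)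
  ... | m , p , nth , p≤n , gap | no none =
    suc m , suc n ,
    next nth (s≤s p≤n) (λ k k<n eq → none (k , k<n , eq)) (λ k p<k k<n → gap k p<k (≤-pred k<n)) ,
    ≤-refl , λ k n<k k≤n _ → <⇒≱ n<k k≤n
  ... | m , p , nth , p≤n , gap | yes (j , j<n , eq) = m , p , nth , m≤n⇒m≤1+n p≤n , gap′
    where
    gap′ : ∀ k → p < k → k ≤ suc n → ¬ IsNew d k
    gap′ k p<k k≤n new with m≤n⇒m<n∨m≡n k≤n
    ... | inj₁ k<n  = gap k p<k (≤-pred k<n) new
    ... | inj₂ refl = new j j<n eq

  new⇒NthNew : ∀ {q} → IsNew d q → ∃[ m ] NthNew d m q
  new⇒NthNew {q} new with lastNew q
  ... | m , p , nth , p≤q , gap with m≤n⇒m<n∨m≡n p≤q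
  ... | inj₁ p<q  = contradiction new (gap q p<q ≤-refl)
  ... | inj₂ refl = m , nth

  NthNew-functional : ∀ {m p q} → NthNew d m p → NthNew d m q → p ≡ q
  NthNew-functional first first = refl
  NthNew-functional (next nth p<q new gap) (next nth′ p<q′ new′ gap′)
    with NthNew-functional nth nth′
  ... | refl with <-cmp _ _
  ... | tri< lt _ _ = contradiction new (gap′ _ p<q lt)
  ... | tri≈ _ eq _ = eq
  ... | tri> _ _ gt = contradiction new′ (gap _ p<q′ gt)

  classOf : ∀ n → ∃[ m ] ∃[ p ] NthNew d m p × d p ≃ d n
  classOf n with firstOccurrence n
  ... | p , new , eq with new⇒NthNew new
  ... | m , nth = m , p , nth , eq

  module _ {label : Labelling d} (isLabel : IsFirstOccurrenceLabelling d label) where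

    label-class : ∀ {m p} → NthNew d m p → ∀ n → d p ≃ d n → labelWord d label n ≡ m
    label-class {p = p} nth n p≃n =
      isLabel nth (d n) (n , ≃-refl {d n}) (≃-sym (d p) (d n) p≃n)

    -- The label of a position is the rank of its class, and a rank determines the first position of
    -- the class.
    labelWord-≡⇔≃ : ∀ m n → labelWord d label m ≡ labelWord d label n ⇔ d m ≃ d n
    labelWord-≡⇔≃ m n = mk⇔
      (λ eq → same-class (classOf m) (classOf n)
        (λ nth p≃m → label-class nth m p≃m) (λ nth p≃n → trans eq (label-class nth n p≃n)))
      (λ m≃n → let a , p , nth , p≃m = classOf m in
        trans (label-class nth m p≃m)
              (sym (label-class nth n (≃-trans (d p) (d m) (d n) p≃m m≃n))))
      where
      same-class : ∀ {ℓ} → (∃[ a ] ∃[ p ] NthNew d a p × d p ≃ d m) →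
        (∃[ a ] ∃[ p ] NthNew d a p × d p ≃ d n) →
        (∀ {a p} → NthNew d a p → d p ≃ d m → ℓ ≡ a) →
        (∀ {a p} → NthNew d a p → d p ≃ d n → ℓ ≡ a) → d m ≃ d n
      same-class (a , p , a-nth , p≃m) (b , q , b-nth , q≃n) ℓ≡a ℓ≡b
        with trans (sym (ℓ≡a a-nth p≃m)) (ℓ≡b b-nth q≃n)
      ... | refl with NthNew-functional a-nth b-nth
      ... | refl = ≃-trans (d m) (d p) (d n) (≃-sym (d p) (d m) p≃m) q≃n

-- Coordinates on S(θ)

module _ (θ : ℝ) where

  V : Point → ℝ
  V (i , j) = fromℕ i +ʳ j · θ

  ·-+ : ∀ j l n → seq ((j + l) · θ) n ≡ seq (j · θ) n ℚ.+ seq (l · θ) n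
  ·-+ zero    l n = sym (trans (cong (ℚ._+ seq (l · θ) n) 0/1) (ℚ.+-identityˡ (seq (l · θ) n)))
  ·-+ (suc j) l n = trans (cong (seq θ n ℚ.+_) (·-+ j l n))
    (sym (ℚ.+-assoc (seq θ n) (seq (j · θ) n) (seq (l · θ) n)))

  ·-* : ∀ j n → seq (j · θ) n ≡ (+ j ℚ./ 1) ℚ.* seq θ n
  ·-* zero    n = trans 0/1 (sym (trans (cong (ℚ._* seq θ n) 0/1) (ℚ.*-zeroˡ (seq θ n))))
  ·-* (suc j) n = begin
    t ℚ.+ seq (j · θ) n       ≡⟨ cong (t ℚ.+_) (·-* j n) ⟩
    t ℚ.+ (+ j ℚ./ 1) ℚ.* t   ≡⟨ step t (+ j ℚ./ 1) ⟩
    (1ℚ ℚ.+ (+ j ℚ./ 1)) ℚ.* t ≡⟨ cong (ℚ._* t) (suc/1 j) ⟨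
    (+ suc j ℚ./ 1) ℚ.* t     ∎
    where
    open ≡-Reasoning
    t = seq θ n
    step : ∀ t j → t ℚ.+ j ℚ.* t ≡ (1ℚ ℚ.+ j) ℚ.* t
    step = solve 2 (λ t j → t :+ j :* t := (con 1ℚ :+ j) :* t) refl

  V-⊕ : ∀ x y n → seq (V (x ⊕ y)) n ≡ seq (V x) n ℚ.+ seq (V y) n
  V-⊕ (i , j) (k , l) n = trans (cong₂ ℚ._+_ (/1-+ i k) (·-+ j l n))
    (interchange (+ i ℚ./ 1) (+ k ℚ./ 1) (seq (j · θ) n) (seq (l · θ) n))
    where
    interchange : ∀ i k j l → (i ℚ.+ k) ℚ.+ (j ℚ.+ l) ≡ (i ℚ.+ j) ℚ.+ (k ℚ.+ l)
    interchange = solve 4 (λ i k j l → (i :+ k) :+ (j :+ l) := (i :+ j) :+ (k :+ l)) refl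

  module _ (irrational : Irrational θ) where

    -- A positive surplus of θ's on the right could be solved for θ, giving the rational `q`, the
    -- difference of `i` and `k` divided by the surplus.
    V-injective₂-+ : ∀ {i j k} d → V (i , j) ≃ V (k , j + d) → j ≡ j + d
    V-injective₂-+ {j = j} zero _ = sym (+-identityʳ j)
    V-injective₂-+ {i} {j} {k} (suc d) eq = contradiction θ≃q (irrational q)
      where
      D = + suc d ℚ./ 1
      instance
        D-positive : ℚ.Positive D
        D-positive = ℚ.normalize-pos (suc d) 1
        D-nonZero : ℚ.NonZero D
        D-nonZero = ℚ.pos⇒nonZero D
      I = + i ℚ./ 1
      K = + k ℚ./ 1
      q : ℚ
      q = (I ℚ.- K) ℚ.* ℚ.1/ D
      scaled : ∀ n → seq (V (k , j + suc d)) n ℚ.- seq (V (i , j)) n ≡ D ℚ.* (seq θ n ℚ.- q)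
      scaled n = begin
        (K ℚ.+ seq ((j + suc d) · θ) n) ℚ.- (I ℚ.+ seq (j · θ) n)
          ≡⟨ cong (λ z → (K ℚ.+ z) ℚ.- (I ℚ.+ seq (j · θ) n)) (·-+ j (suc d) n) ⟩
        (K ℚ.+ (seq (j · θ) n ℚ.+ seq (suc d · θ) n)) ℚ.- (I ℚ.+ seq (j · θ) n)
          ≡⟨ cancel I K (seq (j · θ) n) (seq (suc d · θ) n) ⟩
        seq (suc d · θ) n ℚ.- (I ℚ.- K) ℚ.* 1ℚ
          ≡⟨ cong₂ (λ z w → z ℚ.- (I ℚ.- K) ℚ.* w) (·-* (suc d) n) (sym (ℚ.*-inverseˡ D)) ⟩
        D ℚ.* seq θ n ℚ.- (I ℚ.- K) ℚ.* (ℚ.1/ D ℚ.* D)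
          ≡⟨ factor D (ℚ.1/ D) (seq θ n) (I ℚ.- K) ⟩
        D ℚ.* (seq θ n ℚ.- q) ∎
        where
        open ≡-Reasoning
        cancel : ∀ I K J T → (K ℚ.+ (J ℚ.+ T)) ℚ.- (I ℚ.+ J) ≡ T ℚ.- (I ℚ.- K) ℚ.* 1ℚ
        cancel = solve 4 (λ I K J T → (K :+ (J :+ T)) :- (I :+ J) := T :- (I :- K) :* con 1ℚ) refl
        factor : ∀ D E t Q → D ℚ.* t ℚ.- Q ℚ.* (E ℚ.* D) ≡ D ℚ.* (t ℚ.- Q ℚ.* E)
        factor = solve 4 (λ D E t Q → D :* t :- Q :* (E :* D) := D :* (t :- Q :* E)) refl
      θ≃q : θ ≃ fromℚ q
      θ≃q = scaled-difference⇒≃ (V (k , j + suc d)) (V (i , j)) θ (fromℚ q) D scaled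
              (≃-sym (V (i , j)) (V (k , j + suc d)) eq)

    V-injective₁-+ : ∀ {i j} d → V (i , j) ≃ V (i + d , j) → i ≡ i + d
    V-injective₁-+ {i} zero _ = sym (+-identityʳ i)
    V-injective₁-+ {i} {j} (suc d) eq =
      contradiction eq (constant-difference⇒≄ (V (i , j)) (V (i + suc d , j)) D 0<D diff)
      where
      D = + suc d ℚ./ 1
      0<D : 0ℚ ℚ.< D
      0<D = ℚ.positive⁻¹ D {{ℚ.normalize-pos (suc d) 1}}
      cancel : ∀ I J D → ((I ℚ.+ D) ℚ.+ J) ℚ.- (I ℚ.+ J) ≡ D
      cancel = solve 3 (λ I J D → ((I :+ D) :+ J) :- (I :+ J) := D) refl
      diff : ∀ n → seq (V (i + suc d , j)) n ℚ.- seq (V (i , j)) n ≡ D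
      diff n = trans (cong (λ z → (z ℚ.+ seq (j · θ) n) ℚ.- seq (V (i , j)) n) (/1-+ i (suc d)))
        (cancel (+ i ℚ./ 1) (seq (j · θ) n) D)

    V-injective₂-≤ : ∀ {i j k l} → j ≤ l → V (i , j) ≃ V (k , l) → j ≡ l
    V-injective₂-≤ {i} {j} {k} j≤l with m≤n⇒∃[o]m+o≡n j≤l
    ... | d , refl = V-injective₂-+ {i} {j} {k} d

    V-injective₁-≤ : ∀ {i j k} → i ≤ k → V (i , j) ≃ V (k , j) → i ≡ k
    V-injective₁-≤ {i} {j} i≤k with m≤n⇒∃[o]m+o≡n i≤k
    ... | d , refl = V-injective₁-+ {i} {j} d

    V-injective₂ : ∀ i j k l → V (i , j) ≃ V (k , l) → j ≡ l
    V-injective₂ i j k l eq = [ (λ j≤l → V-injective₂-≤ {i} {j} {k} j≤l eq)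
      , (λ l≤j → sym (V-injective₂-≤ {k} {l} {i} l≤j (≃-sym (V (i , j)) (V (k , l)) eq))) ]′ (≤-total j l)

    V-injective₁ : ∀ i j k → V (i , j) ≃ V (k , j) → i ≡ k
    V-injective₁ i j k eq = [ (λ i≤k → V-injective₁-≤ {i} {j} i≤k eq)
      , (λ k≤i → sym (V-injective₁-≤ {k} {j} k≤i (≃-sym (V (i , j)) (V (k , j)) eq))) ]′ (≤-total i k)

    V-injective : ∀ x y → V x ≃ V y → x ≡ y
    V-injective (i , j) (k , l) eq = cong₂ _,_ (V-injective₁ i j k eq′) j≡l
      where
      j≡l : j ≡ l
      j≡l = V-injective₂ i j k l eq
      eq′ : V (i , j) ≃ V (k , j)
      eq′ = subst (λ z → V (i , j) ≃ V (k , z)) (sym j≡l) eq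

    module _ (s : ℕ → ℝ) (enum : IsIncreasingEnumeration (S θ) s) where
      open IsIncreasingEnumeration enum

      s-mono : ∀ {m n} → m < n → s m <ʳ s n
      s-mono {m} {suc n} (s≤s m≤n) with m≤n⇒m<n∨m≡n m≤n
      ... | inj₁ m<n  = <ʳ-trans (s m) (s n) (s (suc n)) (s-mono m<n) (increasing n)
      ... | inj₂ refl = increasing n

      s-injective : ∀ {m n} → s m ≃ s n → m ≡ n
      s-injective {m} {n} eq with <-cmp m n
      ... | tri< lt _ _ = contradiction (s-mono lt) (<ʳ-irrefl (s m) (s n) eq)
      ... | tri≈ _ m≡n _ = m≡n
      ... | tri> _ _ gt = contradiction (s-mono gt) (<ʳ-irrefl (s n) (s m) (≃-sym (s m) (s n) eq))

      s-cancel-< : ∀ {m n} → s m <ʳ s n → m < n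
      s-cancel-< {m} {n} lt with <-cmp m n
      ... | tri< m<n _ _ = m<n
      ... | tri≈ _ refl _ = contradiction lt (<ʳ-irrefl (s m) (s m) (≃-refl {s m}))
      ... | tri> _ _ n<m = contradiction (<ʳ-trans (s m) (s n) (s m) lt (s-mono n<m))
                             (<ʳ-irrefl (s m) (s m) (≃-refl {s m}))

      coordinates : ℕ → Point
      coordinates n = proj₁ (sound n) , proj₁ (proj₂ (sound n))

      s≃V : ∀ n → s n ≃ V (coordinates n)
      s≃V n = proj₂ (proj₂ (sound n))

      index : Point → ℕ
      index x@(i , j) = proj₁ (complete (V x) (i , j , ≃-refl {V x}))

      V≃s : ∀ x → V x ≃ s (index x)
      V≃s x@(i , j) = proj₂ (complete (V x) (i , j , ≃-refl {V x}))

      V<V⇒index< : ∀ x y → V x <ʳ V y → index x < index y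
      V<V⇒index< x y lt = s-cancel-<
        (<ʳ-respˡ-≃ (V x) (s (index x)) (s (index y)) (V≃s x)
          (<ʳ-respʳ-≃ (V x) (V y) (s (index y)) (V≃s y) lt))

      index<⇒V<V : ∀ x y → index x < index y → V x <ʳ V y
      index<⇒V<V x y lt =
        <ʳ-respˡ-≃ (s (index x)) (V x) (V y) (≃-sym (V x) (s (index x)) (V≃s x))
          (<ʳ-respʳ-≃ (s (index x)) (s (index y)) (V y) (≃-sym (V y) (s (index y)) (V≃s y))
            (s-mono lt))

      -- Injectivity of `V` and of `s` makes `coordinates` and `index` mutually inverse; translation
      -- leaves differences of values, and hence the order, unchanged.
      enumeration : Enumeration
      enumeration = record
        { pt       = coordinates
        ; idx      = index
        ; idx-pt   = λ n → sym (s-injective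
            (≃-trans (s n) (V (coordinates n)) (s (index (coordinates n))) (s≃V n) (V≃s (coordinates n))))
        ; pt-idx   = λ x → sym (V-injective x (coordinates (index x))
            (≃-trans (V x) (s (index x)) (V (coordinates (index x))) (V≃s x) (s≃V (index x))))
        ; idx-mono = λ x y z lt → V<V⇒index< (x ⊕ z) (y ⊕ z)
            (<ʳ-by-difference (V x) (V y) (V (x ⊕ z)) (V (y ⊕ z)) (translate-V x y z)
              (index<⇒V<V x y lt))
        }
        where
        translate-V : ∀ x y z n → seq (V y) n ℚ.- seq (V x) n ≡ seq (V (y ⊕ z)) n ℚ.- seq (V (x ⊕ z)) n
        translate-V x y z n = trans
          (solve 3 (λ x y z → y :- x := (y :+ z) :- (x :+ z)) refl (seq (V x) n) (seq (V y) n) (seq (V z) n))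
          (sym (cong₂ ℚ._-_ (V-⊕ y z n) (V-⊕ x z n)))

      s+s≃V : ∀ m n → s m +ʳ s n ≃ V (coordinates m ⊕ coordinates n)
      s+s≃V m n = ≃-trans (s m +ʳ s n) (V p +ʳ V q) (V (p ⊕ q))
        (+ʳ-cong (s m) (V p) (s n) (V q) (s≃V m) (s≃V n))
        (≃-pointwise (V p +ʳ V q) (V (p ⊕ q)) (λ k → sym (V-⊕ p q k)))
        where
        p = coordinates m
        q = coordinates n

      -- Moving the subtracted terms across turns equality of gaps into equality of two sums in
      -- S(θ), whose coordinates are unique.
      gap≃gap⇔ : ∀ m n → gap s m ≃ gap s n ⇔
                 coordinates (suc m) ⊕ coordinates n ≡ coordinates (suc n) ⊕ coordinates m
      gap≃gap⇔ m n = mk⇔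
        (λ eq → V-injective x y
          (≃-trans (V x) X (V y) (≃-sym X (V x) (s+s≃V (suc m) n))
            (≃-trans X Y (V y) (≃-by-difference (gap s m) (gap s n) X Y regroup eq) (s+s≃V (suc n) m))))
        (λ eq → ≃-by-difference X Y (gap s m) (gap s n) (sym ∘ regroup)
          (≃-trans X (V x) Y (s+s≃V (suc m) n)
            (subst (λ z → V z ≃ Y) (sym eq) (≃-sym Y (V y) (s+s≃V (suc n) m)))))
        where
        x = coordinates (suc m) ⊕ coordinates n
        y = coordinates (suc n) ⊕ coordinates m
        X = s (suc m) +ʳ s n
        Y = s (suc n) +ʳ s m
        regroup : ∀ k → seq (gap s m) k ℚ.- seq (gap s n) k ≡ seq X k ℚ.- seq Y k
        regroup k = solve 4 (λ a b c d → (a :- b) :- (c :- d) := (a :+ d) :- (c :+ b)) refl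
          (seq (s (suc m)) k) (seq (s m) k) (seq (s (suc n)) k) (seq (s n) k)

      -- Equality of Cauchy reals cannot be decided in general; for gaps it reduces to equality of
      -- pairs of natural numbers.
      gap-dec : ∀ m n → Dec (gap s m ≃ gap s n)
      gap-dec m n = Dec.map (⇔-sym (gap≃gap⇔ m n)) (≡-dec _≟_ _≟_ _ _)

      gapWord-letter : ∀ {label} → IsFirstOccurrenceLabelling (gap s) label → ∀ m n →
        let Λ = labelWord (gap s) label in
        Λ m ≡ Λ n ⇔ coordinates (suc m) ⊕ coordinates n ≡ coordinates (suc n) ⊕ coordinates m
      gapWord-letter isLabel m n =
        ⇔-trans (labelWord-≡⇔≃ (gap s) gap-dec isLabel m n) (gap≃gap⇔ m n)

theorem12 : (θ : ℝ) → Irrational θ → fromℕ 1 <ʳ θ → θ <ʳ fromℕ 2 →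
    (s : ℕ → ℝ) → IsIncreasingEnumeration (S θ) s →
    (label : Labelling (gap s)) → IsFirstOccurrenceLabelling (gap s) label →
    let Λ = labelWord (gap s) label in
    Rich∞ Λ ×
    (∀ n → HasUnioccurrentPalindromicSuffix (prefix Λ (suc n)))
theorem12 θ irrational _ _ s enum label isLabel =
  newPalindromes⇒Rich∞ Λ new , λ n → newPalindrome⇒unioccurrent Λ n (new n)
  where
  Λ = labelWord (gap s) label
  new : ∀ n → NewPalindrome Λ (suc n)
  new = newPalindrome (enumeration θ irrational s enum) Λ
          (gapWord-letter θ irrational s enum isLabel)
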